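{- Let $K$ be a field (of any characteristic), $d\ge2$, $\delta\in\{1,-1\}$, $f_t(x)=x^d+c_1(t)x^{d-1}+\dots+c_d(t)$ with $c_i\in K[t]$, and if $\delta=1$ assume $f_t(x)$ is an even polynomial in $x$ (i.e. $f_t(-x)=f_t(x)$ in $K[t,x]$). Let $H_t(x,y)=(\delta y+f_t(x),x)$ for $t\in\overline K$, and let $\mathbf P=(a(t),b(t))\in K[t]^2$, $P_t=(a(t),b(t))$, satisfy: $(\deg A_n)_{n\ge0}$ or $(\deg B_n)_{n\ge0}$ is unbounded, where $A_0=a$, $A_1=\delta b+f_t(a)$, $A_{n+1}=\delta A_{n-1}+f_t(A_n)$, $B_0=b$, $B_1=\delta^{ -1}(a-f_t(b))$, $B_{n+1}=\delta^{ -1}(B_{n-1}-f_t(B_n))$. If $\delta a(t)+b(t)=0$ in $K[t]$, then $\Sigma(\mathbf P):=\{t\in\mathbb A^1(\overline K)\mid P_t\text{ is periodic for }H_t\}$ is infinite.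
   Context: A point $P$ is periodic for $H_t$ if $H_t^n(P)=P$ for some $n\ge1$. -}

module Defs where

open import Level using (Level; _⊔_) renaming (suc to lsuc)
open import Algebra.Bundles using (CommutativeRing)
open import Algebra.Bundles.Raw using (RawRing)
open import Algebra.Morphism.Structures using (module RingMorphisms)
open import Data.Nat using (ℕ; zero; suc; _≤_)
open import Data.Fin using (Fin; toℕ)
open import Data.List using (List; []; _∷_; map; length; _++_; [_])
open import Data.List.Relation.Unary.Any using (Any)
open import Data.Product using (Σ; ∃; _×_; _,_; proj₁; proj₂)
open import Data.Sign using (Sign)
open import Relation.Nullary using (¬_)

record Field (c ℓ : Level) : Set (lsuc (c ⊔ ℓ)) where
  field
    commutativeRing : CommutativeRing c ℓ
  open CommutativeRing commutativeRing public
  field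
    1≉0     : ¬ (1# ≈ 0#)
    inverse : ∀ x → ¬ (x ≈ 0#) → ∃ λ y → (x * y) ≈ 1#

module Poly {c ℓ : Level} (R : RawRing c ℓ) where
  open RawRing R

  Pol : Set c
  Pol = List Carrier

  coeff : Pol → ℕ → Carrier
  coeff []       _       = 0#
  coeff (a ∷ p)  zero    = a
  coeff (a ∷ p)  (suc k) = coeff p k

  _≈P_ : Pol → Pol → Set ℓ
  p ≈P q = ∀ k → coeff p k ≈ coeff q k

  _+P_ : Pol → Pol → Pol
  []      +P q       = q
  (a ∷ p) +P []      = a ∷ p
  (a ∷ p) +P (b ∷ q) = (a + b) ∷ (p +P q)

  -P_ : Pol → Pol
  -P p = map -_ p

  _*P_ : Pol → Pol → Pol
  []      *P q = []
  (a ∷ p) *P q = map (a *_) q +P (0# ∷ (p *P q))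

  X : Pol
  X = 0# ∷ 1# ∷ []

  C : Carrier → Pol
  C a = a ∷ []

  eval : Pol → Carrier → Carrier
  eval []      x = 0#
  eval (a ∷ p) x = a + x * eval p x

  rawRingP : RawRing c ℓ
  rawRingP = record
    { Carrier = Pol ; _≈_ = _≈P_ ; _+_ = _+P_ ; _*_ = _*P_
    ; -_ = -P_ ; 0# = [] ; 1# = 1# ∷ [] }

module RingOps {c ℓ : Level} (R : RawRing c ℓ) where
  open RawRing R

  pow : Carrier → ℕ → Carrier
  pow x zero    = 1#
  pow x (suc n) = x * pow x n

  sumFin : (n : ℕ) → (Fin n → Carrier) → Carrier
  sumFin zero    g = 0#
  sumFin (suc n) g = g Data.Fin.zero + sumFin n (λ i → g (Data.Fin.suc i))

  ⟦_⟧ˢ : Sign → Carrier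
  ⟦ Sign.+ ⟧ˢ = 1#
  ⟦ Sign.- ⟧ˢ = - 1#

  -- f(x) = x^d + c_1 x^{d-1} + ... + c_d, where the coefficients
  -- c_i (i = 1..d, stored at index i-1 : Fin d) live in some set Coef
  -- and are interpreted in R by ι.
  fGen : {a : Level} {Coef : Set a} → (ι : Coef → Carrier) →
         (d : ℕ) → (Fin d → Coef) → Carrier → Carrier
  fGen ι d cs x =
    pow x d + sumFin d (λ i → ι (cs i) * pow x (d Data.Nat.∸ suc (toℕ i)))

module Setting {c ℓ : Level} (K : Field c ℓ) where
  private module KF = Field K
  open Poly KF.rawRing public
    renaming (Pol to K[t]; coeff to coeffK; _≈P_ to _≈K[t]_;
              rawRingP to K[t]-rawRing)

  module KtX = Poly K[t]-rawRing

  fKtX : (d : ℕ) → (Fin d → K[t]) → KtX.Pol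
  fKtX d cs = RingOps.fGen KtX.rawRingP KtX.C d cs KtX.X

  fKtX-neg : (d : ℕ) → (Fin d → K[t]) → KtX.Pol
  fKtX-neg d cs = RingOps.fGen KtX.rawRingP KtX.C d cs (KtX.-P KtX.X)

  IsEvenInX : (d : ℕ) → (Fin d → K[t]) → Set ℓ
  IsEvenInX d cs = fKtX-neg d cs KtX.≈P fKtX d cs

  fK[t] : (d : ℕ) → (Fin d → K[t]) → K[t] → K[t]
  fK[t] d cs = RingOps.fGen K[t]-rawRing (λ p → p) d cs

  private
    module KR = RingOps K[t]-rawRing

  -- the sequences A_n and B_n; note δ⁻¹ = δ since δ ∈ {1,-1}
  A : (δ : Sign) (d : ℕ) (cs : Fin d → K[t]) (a b : K[t]) → ℕ → K[t]
  A δ d cs a b zero          = a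
  A δ d cs a b (suc zero)    = (KR.⟦ δ ⟧ˢ *P b) +P fK[t] d cs a
  A δ d cs a b (suc (suc n)) =
    (KR.⟦ δ ⟧ˢ *P A δ d cs a b n) +P fK[t] d cs (A δ d cs a b (suc n))

  B : (δ : Sign) (d : ℕ) (cs : Fin d → K[t]) (a b : K[t]) → ℕ → K[t]
  B δ d cs a b zero          = b
  B δ d cs a b (suc zero)    = KR.⟦ δ ⟧ˢ *P (a +P (-P fK[t] d cs b))
  B δ d cs a b (suc (suc n)) =
    KR.⟦ δ ⟧ˢ *P (B δ d cs a b n +P (-P fK[t] d cs (B δ d cs a b (suc n))))

  DegUnbounded : (ℕ → K[t]) → Set ℓ
  DegUnbounded u = ∀ N → ∃ λ n → ∃ λ k → N ≤ k × ¬ (coeffK (u n) k KF.≈ KF.0#)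

record AlgebraicClosure {c ℓ : Level} (K : Field c ℓ) (c' ℓ' : Level)
       : Set (lsuc (c ⊔ ℓ ⊔ c' ⊔ ℓ')) where
  private module KF = Field K
  field
    L    : Field c' ℓ'
  private module LF = Field L
  module PL = Poly LF.rawRing
  module PK = Poly KF.rawRing
  field
    ι          : KF.Carrier → LF.Carrier
    ι-isRingHom : RingMorphisms.IsRingHomomorphism KF.rawRing LF.rawRing ι
    algClosed  : ∀ (as : List LF.Carrier) → 1 ≤ length as →
                 ∃ λ x → PL.eval (as ++ [ LF.1# ]) x LF.≈ LF.0#
    algebraic  : ∀ (y : LF.Carrier) → ∃ λ (p : PK.Pol) →
                 (∃ λ k → ¬ (PK.coeff p k KF.≈ KF.0#)) ×
                 (PL.eval (map ι p) y LF.≈ LF.0#)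

  open Field L public using () renaming (Carrier to K̄; _≈_ to _≈̄_)

  evalAt : PK.Pol → K̄ → K̄
  evalAt p t = PL.eval (map ι p) t

  H : (δ : Sign) (d : ℕ) (cs : Fin d → PK.Pol) (t : K̄) → K̄ × K̄ → K̄ × K̄
  H δ d cs t (x , y) =
    (RingOps.⟦_⟧ˢ LF.rawRing δ LF.* y LF.+
       RingOps.fGen LF.rawRing (λ p → evalAt p t) d cs x) , x

  iter : {X : Set c'} → (X → X) → ℕ → X → X
  iter g zero    x = x
  iter g (suc n) x = g (iter g n x)

  Periodic : (δ : Sign) (d : ℕ) (cs : Fin d → PK.Pol) (a b : PK.Pol) → K̄ → Set ℓ'
  Periodic δ d cs a b t =
    Σ ℕ λ n → 1 ≤ n ×
      (proj₁ (iter (H δ d cs t) n (evalAt a t , evalAt b t)) ≈̄ evalAt a t ×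
       proj₂ (iter (H δ d cs t) n (evalAt a t , evalAt b t)) ≈̄ evalAt b t)

  SigmaInfinite : (δ : Sign) (d : ℕ) (cs : Fin d → PK.Pol) (a b : PK.Pol) → Set (c' ⊔ ℓ')
  SigmaInfinite δ d cs a b =
    ¬ (∃ λ (l : List K̄) → ∀ t → Periodic δ d cs a b t → Any (t ≈̄_) l)

{-# OPTIONS --safe #-}
module Submission where

-- Write the orbit of P in K̄[t]² as Q_n = (A_n, A_{n-1}), and let s(x,y) = (-δy, -δx).
-- The hypotheses on f and on (a,b) say that H ∘ s ∘ H = s and s(P) = P. Hence, modulo
-- any polynomial q, s(Q_n) ≡ Q_n implies Q_{2n} ≡ Q_0; and s(Q_n) ≡ Q_n holds as soon as
-- q divides e_n = A_n + δA_{n-1}. With q = X - t, every root of e_n lies in Σ(P).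
--
-- Suppose Σ(P) ⊆ S with S finite, and let M exceed the degrees of the entries of Q_2 - Q_0.
-- There are finitely many products q of M factors X - s with s ∈ S; let L be a common
-- multiple of the periods of the orbit modulo those q for which it is periodic.
-- Take n ≡ 1 mod L with deg e_n ≥ M. As all roots of e_n lie in S, such a q divides e_n,
-- so 2n is a period modulo q, hence so are L and 2. Then Q_2 ≡ Q_0 modulo q, and
-- deg q = M forces Q_2 = Q_0, which contradicts the growth of the degrees.
--
-- The conclusion is a negation, so excluded middle may be used for finitely many propositions.

open import Defs
open import Level using (Level; _⊔_)
open import Algebra.Bundles using (AbelianGroup; CommutativeRing; CommutativeSemigroup)
open import Algebra.Bundles.Raw using (RawRing)
open import Algebra.Definitions using (Congruent₂)
open import Algebra.Morphism.Construct.Composition using (isRingHomomorphism)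
open import Algebra.Morphism.Structures using (module RingMorphisms)
import Algebra.Properties.CommutativeSemigroup
open import Algebra.Structures using (IsAbelianGroup)
open import Data.Empty using (⊥)
open import Data.Fin using (Fin; toℕ)
open import Data.Fin.Properties using (toℕ<n)
import Data.List as List
open import Data.List using (List; []; _∷_; map)
open import Data.List.Relation.Unary.All as All using (All; []; _∷_)
import Data.List.Relation.Unary.All.Properties as Allₚ
open import Data.List.Relation.Unary.Any as Any using (Any; here)
import Data.List.Relation.Unary.Any.Properties as Anyₚ
open import Data.Nat as ℕ using (ℕ; zero; suc; _≤_; _<_; _∸_; z≤n; s≤s)
open import Data.Nat.GeneralisedArithmetic using (fold; fold-+)
import Data.Nat.Properties as ℕₚ
open import Data.Product using (∃; _×_; _,_; proj₁; proj₂)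
open import Data.Product.Relation.Binary.Pointwise.NonDependent using (×-setoid)
open import Data.Sign using (Sign)
open import Data.Sum using (_⊎_; inj₁; inj₂)
open import Relation.Binary.Bundles using (Setoid)
open import Relation.Binary.Core using (Rel)
open import Relation.Binary.PropositionalEquality as ≡ using (_≡_)
open import Relation.Nullary using (¬_; yes; no; contradiction)
open import Relation.Nullary.Decidable using (¬¬-excluded-middle)

private variable
  c ℓ c′ ℓ′ a p : Level

-- The expression `fGen` under congruences and ring homomorphisms.

module _ (R : RawRing c ℓ) where
  open RawRing R
  open RingOps R

  -- The relation is left arbitrary because several are used: equality in a ring, `_≋_`, and
  -- congruence modulo a polynomial.
  module FGenCong (_~_ : Rel Carrier ℓ′) (refl : ∀ {x} → x ~ x)
                  (+-cong : Congruent₂ _~_ _+_) (*-cong : Congruent₂ _~_ _*_) where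

    pow-cong : ∀ {x y} n → x ~ y → pow x n ~ pow y n
    pow-cong zero    x~y = refl
    pow-cong (suc n) x~y = *-cong x~y (pow-cong n x~y)

    sumFin-cong : ∀ n {g h : Fin n → Carrier} → (∀ i → g i ~ h i) → sumFin n g ~ sumFin n h
    sumFin-cong zero    g~h = refl
    sumFin-cong (suc n) g~h = +-cong (g~h Fin.zero) (sumFin-cong n (λ i → g~h (Fin.suc i)))

    fGen-cong : ∀ {Coef : Set a} {ι κ : Coef → Carrier} d cs {x y} →
                (∀ k → ι k ~ κ k) → x ~ y → fGen ι d cs x ~ fGen κ d cs y
    fGen-cong d cs ι~κ x~y =
      +-cong (pow-cong d x~y)
             (sumFin-cong d (λ i → *-cong (ι~κ (cs i)) (pow-cong (d ∸ suc (toℕ i)) x~y)))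

module RingHom (R₁ : RawRing c ℓ) (R₂ : CommutativeRing c′ ℓ′) where
  private
    module R₁ = RawRing R₁
    module O₁ = RingOps R₁
  open CommutativeRing R₂ hiding (zero)
  open RingOps rawRing
  open RingMorphisms R₁ rawRing using (IsRingHomomorphism)

  mkHom : (φ : R₁.Carrier → Carrier) →
    (∀ {x y} → x R₁.≈ y → φ x ≈ φ y) →
    (∀ x y → φ (x R₁.+ y) ≈ φ x + φ y) →
    (∀ x y → φ (x R₁.* y) ≈ φ x * φ y) →
    (∀ x → φ (R₁.- x) ≈ - φ x) → φ R₁.0# ≈ 0# → φ R₁.1# ≈ 1# → IsRingHomomorphism φ
  mkHom φ φ-cong φ-+ φ-* φ-- φ-0 φ-1 = record
    { isSemiringHomomorphism = record
      { isNearSemiringHomomorphism = record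
        { +-isMonoidHomomorphism = record
          { isMagmaHomomorphism = record
            { isRelHomomorphism = record { cong = φ-cong } ; homo = φ-+ }
          ; ε-homo = φ-0 }
        ; *-homo = φ-* }
      ; 1#-homo = φ-1 }
    ; -‿homo = φ-- }

  module _ {φ : R₁.Carrier → Carrier} (φ-hom : IsRingHomomorphism φ) where
    open IsRingHomomorphism φ-hom

    pow-homo : ∀ x n → φ (O₁.pow x n) ≈ pow (φ x) n
    pow-homo x zero    = 1#-homo
    pow-homo x (suc n) = trans (*-homo x _) (*-cong refl (pow-homo x n))

    sumFin-homo : ∀ n g → φ (O₁.sumFin n g) ≈ sumFin n (λ i → φ (g i))
    sumFin-homo zero    g = 0#-homo
    sumFin-homo (suc n) g =
      trans (+-homo _ _) (+-cong refl (sumFin-homo n (λ i → g (Fin.suc i))))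

    fGen-homo : ∀ {Coef : Set a} (ι : Coef → R₁.Carrier) d cs x →
                φ (O₁.fGen ι d cs x) ≈ fGen (λ k → φ (ι k)) d cs (φ x)
    fGen-homo ι d cs x =
      trans (+-homo _ _) (+-cong (pow-homo x d) (trans (sumFin-homo d _)
        (FGenCong.sumFin-cong rawRing _≈_ refl +-cong *-cong d
          (λ i → trans (*-homo _ _) (*-cong refl (pow-homo x (d ∸ suc (toℕ i))))))))

    sign-homo : ∀ δ → φ O₁.⟦ δ ⟧ˢ ≈ ⟦ δ ⟧ˢ
    sign-homo Sign.+ = 1#-homo
    sign-homo Sign.- = trans (-‿homo _) (-‿cong 1#-homo)

-- The polynomial ring over a commutative ring: ring laws, evaluation, division by `X - t`.

module PolynomialRing (R : CommutativeRing c ℓ) where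
  open CommutativeRing R hiding (zero)
  open import Algebra.Properties.Ring ring using (-0#≈0#)
  open import Algebra.Properties.CommutativeSemigroup +-commutativeSemigroup using (interchange)
  open Poly rawRing public

  -- A record rather than the function type _≈P_, so that p and q can be inferred.
  infix 4 _≋_
  record _≋_ (p q : Pol) : Set ℓ where
    constructor pointwise
    field at : p ≈P q
  open _≋_ public

  coeff-+ : ∀ p q k → coeff (p +P q) k ≈ coeff p k + coeff q k
  coeff-+ []      q       k       = sym (+-identityˡ _)
  coeff-+ (a ∷ p) []      k       = sym (+-identityʳ _)
  coeff-+ (a ∷ p) (b ∷ q) zero    = refl
  coeff-+ (a ∷ p) (b ∷ q) (suc k) = coeff-+ p q k

  coeff-neg : ∀ p k → coeff (-P p) k ≈ - coeff p k
  coeff-neg []      k       = sym -0#≈0#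
  coeff-neg (a ∷ p) zero    = refl
  coeff-neg (a ∷ p) (suc k) = coeff-neg p k

  scale : Carrier → Pol → Pol
  scale a = map (a *_)

  coeff-scale : ∀ a p k → coeff (scale a p) k ≈ a * coeff p k
  coeff-scale a []      k       = sym (zeroʳ a)
  coeff-scale a (b ∷ p) zero    = refl
  coeff-scale a (b ∷ p) (suc k) = coeff-scale a p k

  private
    ≋-refl : ∀ {p} → p ≋ p
    ≋-refl = pointwise λ k → refl

    ≋-sym : ∀ {p q} → p ≋ q → q ≋ p
    ≋-sym p≋q = pointwise λ k → sym (at p≋q k)

    ≋-trans : ∀ {p q r} → p ≋ q → q ≋ r → p ≋ r
    ≋-trans p≋q q≋r = pointwise λ k → trans (at p≋q k) (at q≋r k)

    +P-cong : Congruent₂ _≋_ _+P_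
    +P-cong {p} {p′} {q} {q′} p≋p′ q≋q′ = pointwise λ k →
      trans (coeff-+ p q k) (trans (+-cong (at p≋p′ k) (at q≋q′ k)) (sym (coeff-+ p′ q′ k)))

  +P-isAbelianGroup : IsAbelianGroup _≋_ _+P_ [] -P_
  +P-isAbelianGroup = record
    { isGroup = record
      { isMonoid = record
        { isSemigroup = record
          { isMagma = record
            { isEquivalence = record { refl = ≋-refl ; sym = ≋-sym ; trans = ≋-trans }
            ; ∙-cong = +P-cong }
          ; assoc = λ p q r → pointwise λ k →
              trans (coeff-+ (p +P q) r k) (trans (+-cong (coeff-+ p q k) refl)
                (trans (+-assoc _ _ _) (sym (trans (coeff-+ p (q +P r) k)
                  (+-cong refl (coeff-+ q r k)))))) }
        ; identity = (λ p → ≋-refl)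
                   , (λ p → pointwise λ k → trans (coeff-+ p [] k) (+-identityʳ _)) }
      ; inverse = (λ p → pointwise λ k → trans (coeff-+ (-P p) p k)
                    (trans (+-cong (coeff-neg p k) refl) (-‿inverseˡ _)))
                , (λ p → pointwise λ k → trans (coeff-+ p (-P p) k)
                    (trans (+-cong refl (coeff-neg p k)) (-‿inverseʳ _)))
      ; ⁻¹-cong = λ {p} {q} p≋q → pointwise λ k →
          trans (coeff-neg p k) (trans (-‿cong (at p≋q k)) (sym (coeff-neg q k))) }
    ; comm = λ p q → pointwise λ k →
        trans (coeff-+ p q k) (trans (+-comm _ _) (sym (coeff-+ q p k))) }

  private
    +P-abelianGroup : AbelianGroup c ℓ
    +P-abelianGroup = record { isAbelianGroup = +P-isAbelianGroup }
    module +P = AbelianGroup +P-abelianGroup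

    +P-commutativeSemigroup : CommutativeSemigroup c ℓ
    +P-commutativeSemigroup = record { isCommutativeSemigroup = +P.isCommutativeSemigroup }
    module +P-Properties = Algebra.Properties.CommutativeSemigroup +P-commutativeSemigroup
  open import Relation.Binary.Reasoning.Setoid +P.setoid

  ∷-cong : ∀ {a b p q} → a ≈ b → p ≋ q → (a ∷ p) ≋ (b ∷ q)
  ∷-cong a≈b p≋q = pointwise λ where
    zero    → a≈b
    (suc k) → at p≋q k

  tail-cong : ∀ {a b p q} → (a ∷ p) ≋ (b ∷ q) → p ≋ q
  tail-cong e = pointwise λ k → at e (suc k)

  ∷≋[] : ∀ {a p} → a ≈ 0# → p ≋ [] → (a ∷ p) ≋ []
  ∷≋[] a≈0 p≋[] = pointwise λ where
    zero    → a≈0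
    (suc k) → at p≋[] k

  scale-cong : ∀ {a b p q} → a ≈ b → p ≋ q → scale a p ≋ scale b q
  scale-cong {a} {b} {p} {q} a≈b p≋q = pointwise λ k →
    trans (coeff-scale a p k) (trans (*-cong a≈b (at p≋q k)) (sym (coeff-scale b q k)))

  scale-+ : ∀ a p q → scale a (p +P q) ≋ (scale a p +P scale a q)
  scale-+ a p q = pointwise λ k →
    trans (coeff-scale a (p +P q) k) (trans (*-cong refl (coeff-+ p q k))
      (trans (distribˡ _ _ _) (sym (trans (coeff-+ (scale a p) (scale a q) k)
        (+-cong (coeff-scale a p k) (coeff-scale a q k))))))

  scale-scale : ∀ a b p → scale (a * b) p ≋ scale a (scale b p)
  scale-scale a b p = pointwise λ k →
    trans (coeff-scale (a * b) p k) (trans (*-assoc _ _ _)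
      (sym (trans (coeff-scale a (scale b p) k) (*-cong refl (coeff-scale b p k)))))

  scale-1 : ∀ p → scale 1# p ≋ p
  scale-1 p = pointwise λ k → trans (coeff-scale 1# p k) (*-identityˡ _)

  scale-0 : ∀ p → scale 0# p ≋ []
  scale-0 p = pointwise λ k → trans (coeff-scale 0# p k) (zeroˡ _)

  private
    *P-congˡ : ∀ p {q q′} → q ≋ q′ → (p *P q) ≋ (p *P q′)
    *P-congˡ []      q≋q′ = ≋-refl
    *P-congˡ (a ∷ p) q≋q′ = +P-cong (scale-cong refl q≋q′) (∷-cong refl (*P-congˡ p q≋q′))

    *P-zeroʳ : ∀ p → (p *P []) ≋ []
    *P-zeroʳ []      = ≋-refl
    *P-zeroʳ (a ∷ p) = ∷≋[] refl (*P-zeroʳ p)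

    0∷-+ : ∀ p q → (0# ∷ (p +P q)) ≋ ((0# ∷ p) +P (0# ∷ q))
    0∷-+ p q = ∷-cong (sym (+-identityˡ 0#)) ≋-refl

    *P-distribˡ : ∀ p q r → (p *P (q +P r)) ≋ ((p *P q) +P (p *P r))
    *P-distribˡ []      q r = ≋-refl
    *P-distribˡ (a ∷ p) q r = begin
      scale a (q +P r) +P (0# ∷ (p *P (q +P r)))
        ≈⟨ +P-cong (scale-+ a q r) (∷-cong refl (*P-distribˡ p q r)) ⟩
      (scale a q +P scale a r) +P (0# ∷ ((p *P q) +P (p *P r)))
        ≈⟨ +P.∙-cong ≋-refl (0∷-+ (p *P q) (p *P r)) ⟩
      (scale a q +P scale a r) +P ((0# ∷ (p *P q)) +P (0# ∷ (p *P r)))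
        ≈⟨ +P-Properties.interchange (scale a q) (scale a r) _ _ ⟩
      ((a ∷ p) *P q) +P ((a ∷ p) *P r) ∎

    -- The recursion that defines `_*P_`, transposed to the second factor. Commutativity then
    -- follows by induction on the first.
    *P-∷ʳ : ∀ p b q → (p *P (b ∷ q)) ≋ (scale b p +P (0# ∷ (p *P q)))
    *P-∷ʳ []      b q = ≋-sym (∷≋[] refl ≋-refl)
    *P-∷ʳ (a ∷ p) b q = ∷-cong (+-cong (*-comm a b) refl) (begin
      scale a q +P (p *P (b ∷ q))                   ≈⟨ +P.∙-cong ≋-refl (*P-∷ʳ p b q) ⟩
      scale a q +P (scale b p +P (0# ∷ (p *P q)))   ≈⟨ +P-Properties.x∙yz≈y∙xz (scale a q) (scale b p) _ ⟩
      scale b p +P ((a ∷ p) *P q)                   ∎)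

    *P-comm : ∀ p q → (p *P q) ≋ (q *P p)
    *P-comm []      q = ≋-sym (*P-zeroʳ q)
    *P-comm (a ∷ p) q = begin
      scale a q +P (0# ∷ (p *P q))  ≈⟨ +P.∙-cong ≋-refl (∷-cong refl (*P-comm p q)) ⟩
      scale a q +P (0# ∷ (q *P p))  ≈⟨ *P-∷ʳ q a p ⟨
      q *P (a ∷ p)                  ∎

    *P-distribʳ : ∀ p q r → ((q +P r) *P p) ≋ ((q *P p) +P (r *P p))
    *P-distribʳ p q r = begin
      (q +P r) *P p         ≈⟨ *P-comm (q +P r) p ⟩
      p *P (q +P r)         ≈⟨ *P-distribˡ p q r ⟩
      (p *P q) +P (p *P r)  ≈⟨ +P-cong (*P-comm p q) (*P-comm p r) ⟩
      (q *P p) +P (r *P p)  ∎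

    0∷-* : ∀ p q → ((0# ∷ p) *P q) ≋ (0# ∷ (p *P q))
    0∷-* p q = +P-cong (scale-0 q) ≋-refl

    scale-* : ∀ a p q → (scale a p *P q) ≋ scale a (p *P q)
    scale-* a []      q = ≋-refl
    scale-* a (b ∷ p) q = begin
      scale (a * b) q +P (0# ∷ (scale a p *P q))
        ≈⟨ +P-cong (scale-scale a b q) (∷-cong (sym (zeroʳ a)) (scale-* a p q)) ⟩
      scale a (scale b q) +P scale a (0# ∷ (p *P q))
        ≈⟨ scale-+ a (scale b q) _ ⟨
      scale a ((b ∷ p) *P q) ∎

    *P-assoc : ∀ p q r → ((p *P q) *P r) ≋ (p *P (q *P r))
    *P-assoc []      q r = ≋-refl
    *P-assoc (a ∷ p) q r = begin
      (scale a q +P (0# ∷ (p *P q))) *P r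
        ≈⟨ *P-distribʳ r (scale a q) (0# ∷ (p *P q)) ⟩
      (scale a q *P r) +P ((0# ∷ (p *P q)) *P r)
        ≈⟨ +P-cong (scale-* a q r) (≋-trans (0∷-* (p *P q) r) (∷-cong refl (*P-assoc p q r))) ⟩
      (a ∷ p) *P (q *P r) ∎

    *P-identityˡ : ∀ p → ((1# ∷ []) *P p) ≋ p
    *P-identityˡ p = begin
      scale 1# p +P (0# ∷ [])  ≈⟨ +P-cong (scale-1 p) (∷≋[] refl ≋-refl) ⟩
      p +P []                  ≈⟨ +P.identityʳ p ⟩
      p                        ∎

  polynomialRing : CommutativeRing c ℓ
  polynomialRing = record
    { isCommutativeRing = record
      { isRing = record
        { +-isAbelianGroup = +P-isAbelianGroup
        ; *-cong = λ {p} {p′} {q} {q′} p≋p′ q≋q′ → begin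
            p *P q    ≈⟨ *P-congˡ p q≋q′ ⟩
            p *P q′   ≈⟨ *P-comm p q′ ⟩
            q′ *P p   ≈⟨ *P-congˡ q′ p≋p′ ⟩
            q′ *P p′  ≈⟨ *P-comm q′ p′ ⟩
            p′ *P q′  ∎
        ; *-assoc = *P-assoc
        ; *-identity = *P-identityˡ
                     , λ p → ≋-trans (*P-comm p (1# ∷ [])) (*P-identityˡ p)
        ; distrib = *P-distribˡ , *P-distribʳ }
      ; *-comm = *P-comm } }

  module PR = CommutativeRing polynomialRing

  eval-zero : ∀ p x → p ≋ [] → eval p x ≈ 0#
  eval-zero []      x p≋[] = refl
  eval-zero (a ∷ p) x p≋[] =
    trans (+-cong (at p≋[] zero)
                  (trans (*-cong refl (eval-zero p x (pointwise λ k → at p≋[] (suc k)))) (zeroʳ x)))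
          (+-identityˡ 0#)

  eval-cong : ∀ p q x → p ≋ q → eval p x ≈ eval q x
  eval-cong []      q       x p≋q = sym (eval-zero q x (PR.sym p≋q))
  eval-cong (a ∷ p) []      x p≋q = eval-zero (a ∷ p) x p≋q
  eval-cong (a ∷ p) (b ∷ q) x p≋q =
    +-cong (at p≋q zero) (*-cong refl (eval-cong p q x (tail-cong p≋q)))

  eval-+ : ∀ p q x → eval (p +P q) x ≈ eval p x + eval q x
  eval-+ []      q       x = sym (+-identityˡ _)
  eval-+ (a ∷ p) []      x = sym (+-identityʳ _)
  eval-+ (a ∷ p) (b ∷ q) x =
    trans (+-cong refl (trans (*-cong refl (eval-+ p q x)) (distribˡ _ _ _))) (interchange _ _ _ _)

  eval-scale : ∀ a p x → eval (scale a p) x ≈ a * eval p x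
  eval-scale a []      x = sym (zeroʳ a)
  eval-scale a (b ∷ p) x =
    trans (+-cong refl (trans (*-cong refl (eval-scale a p x)) (x∙yz≈y∙xz x a _)))
          (sym (distribˡ _ _ _))
    where open import Algebra.Properties.CommutativeSemigroup *-commutativeSemigroup using (x∙yz≈y∙xz)

  eval-C : ∀ a x → eval (C a) x ≈ a
  eval-C a x = trans (+-cong refl (zeroʳ x)) (+-identityʳ a)

  eval-X : ∀ x → eval X x ≈ x
  eval-X x = trans (+-identityˡ _) (trans (*-cong refl (eval-C 1# x)) (*-identityʳ x))

  eval-* : ∀ p q x → eval (p *P q) x ≈ eval p x * eval q x
  eval-* []      q x = sym (zeroˡ _)
  eval-* (a ∷ p) q x =
    trans (eval-+ (scale a q) (0# ∷ (p *P q)) x)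
      (trans (+-cong (eval-scale a q x)
                     (trans (+-identityˡ _) (trans (*-cong refl (eval-* p q x)) (sym (*-assoc _ _ _)))))
             (sym (distribʳ _ _ _)))

  eval-neg : ∀ p x → eval (-P p) x ≈ - eval p x
  eval-neg []      x = sym -0#≈0#
  eval-neg (a ∷ p) x =
    trans (+-cong refl (trans (*-cong refl (eval-neg p x)) (sym (-‿distribʳ-* x _)))) (-‿+-comm a _)
    where open import Algebra.Properties.Ring ring using (-‿distribʳ-*; -‿+-comm)

  eval-hom : ∀ x → RingMorphisms.IsRingHomomorphism PR.rawRing rawRing (λ p → eval p x)
  eval-hom x = RingHom.mkHom PR.rawRing R (λ p → eval p x)
    (λ {p} {q} → eval-cong p q x) (λ p q → eval-+ p q x) (λ p q → eval-* p q x)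
    (λ p → eval-neg p x) refl (eval-C 1# x)

  linear : Carrier → Pol
  linear t = (- t) ∷ 1# ∷ []

  private
    linear-* : ∀ t p → (linear t *P p) ≋ (scale (- t) p +P (0# ∷ p))
    linear-* t p = PR.+-cong (PR.refl {scale (- t) p}) (∷-cong refl (PR.*-identityˡ p))

  -- Horner's scheme: the values at t of the successive tails of p are the
  -- coefficients of the quotient by X - t.
  remainder : ∀ t p → ∃ λ h → p ≋ ((linear t *P h) +P C (eval p t))
  remainder t []      = [] , PR.sym (∷≋[] (+-identityʳ _) (∷≋[] refl PR.refl))
  remainder t (a ∷ p) with remainder t p
  ... | h , p≋ = r ∷ h , PR.sym (begin
    (linear t *P (r ∷ h)) +P C (a + t * r)
      ≈⟨ PR.+-cong (linear-* t (r ∷ h)) (PR.refl {C (a + t * r)}) ⟩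
    ((- t * r + 0#) + (a + t * r)) ∷ ((scale (- t) h +P (r ∷ h)) +P [])
      ≈⟨ ∷-cong head (PR.trans (PR.+-identityʳ _) (PR.+-cong (PR.refl {scale (- t) h})
           (PR.sym (∷-cong (+-identityˡ r) (PR.+-identityʳ h))))) ⟩
    a ∷ (scale (- t) h +P ((0# ∷ h) +P C r))
      ≈⟨ ∷-cong refl (PR.+-assoc (scale (- t) h) (0# ∷ h) (C r)) ⟨
    a ∷ ((scale (- t) h +P (0# ∷ h)) +P C r)
      ≈⟨ ∷-cong refl (PR.+-cong (linear-* t h) (PR.refl {C r})) ⟨
    a ∷ ((linear t *P h) +P C r)
      ≈⟨ ∷-cong refl p≋ ⟨
    a ∷ p ∎)
    where
    r = eval p t
    open import Algebra.Properties.Ring ring using (-‿distribˡ-*)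
    head : (- t * r + 0#) + (a + t * r) ≈ a
    head = trans (+-cong (trans (+-identityʳ _) (sym (-‿distribˡ-* t r))) (+-comm a _))
             (trans (sym (+-assoc _ _ _)) (trans (+-cong (-‿inverseˡ _) refl) (+-identityˡ a)))

  root⇒factor : ∀ t p → eval p t ≈ 0# → ∃ λ h → p ≋ (linear t *P h)
  root⇒factor t p pt≈0 with remainder t p
  ... | h , p≋ = h , PR.trans p≋ (PR.trans
    (PR.+-cong (PR.refl {linear t *P h}) (∷≋[] pt≈0 PR.refl)) (PR.+-identityʳ _))

  linear-cong : ∀ {s t} → s ≈ t → linear s ≋ linear t
  linear-cong s≈t = ∷-cong (-‿cong s≈t) PR.refl

  eval-linear : ∀ t → eval (linear t) t ≈ 0#
  eval-linear t = trans (+-cong refl (trans (*-cong refl (eval-C 1# t)) (*-identityʳ t))) (-‿inverseˡ t)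

  -- Degrees expressed through vanishing coefficients.

  -- Stands for `deg p < n`. Equality of coefficients is not assumed decidable and lists may end in
  -- zeros, so no degree function is available.
  Vanish : Pol → ℕ → Set ℓ
  Vanish p n = ∀ k → n ≤ k → coeff p k ≈ 0#

  -- Stands for `deg p ≤ n` with a named coefficient at `n`. Since `a` may be zero, the rules for
  -- sums and products carry no side condition, and `a = 0` recovers the bound `deg p < n`.
  record Top (p : Pol) (n : ℕ) (a : Carrier) : Set ℓ where
    constructor top
    field
      leading : coeff p n ≈ a
      above   : Vanish p (suc n)
  open Top public

  vanish-length : ∀ p → Vanish p (List.length p)
  vanish-length []      k       _         = refl
  vanish-length (a ∷ p) (suc k) (s≤s n≤k) = vanish-length p k n≤k

  vanish-mono : ∀ {p m n} → m ≤ n → Vanish p m → Vanish p n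
  vanish-mono m≤n v k n≤k = v k (ℕₚ.≤-trans m≤n n≤k)

  vanish-cong : ∀ {p q n} → p ≋ q → Vanish p n → Vanish q n
  vanish-cong p≋q v k n≤k = trans (sym (at p≋q k)) (v k n≤k)

  vanish-+ : ∀ {p q n} → Vanish p n → Vanish q n → Vanish (p +P q) n
  vanish-+ {p} {q} v w k n≤k =
    trans (coeff-+ p q k) (trans (+-cong (v k n≤k) (w k n≤k)) (+-identityˡ 0#))

  top⇒vanish : ∀ {p n} → Top p n 0# → Vanish p n
  top⇒vanish t k n≤k with ℕₚ.m≤n⇒m<n∨m≡n n≤k
  ... | inj₁ n<k    = above t k n<k
  ... | inj₂ ≡.refl = leading t

  vanish⇒top : ∀ {p n} → Vanish p n → Top p n 0#
  vanish⇒top v = top (v _ ℕₚ.≤-refl) (λ k n<k → v k (ℕₚ.<⇒≤ n<k))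

  vanish-suc⇒top : ∀ {p n} → Vanish p (suc n) → Top p n (coeff p n)
  vanish-suc⇒top v = top refl v

  top-cong : ∀ {p q n a b} → p ≋ q → a ≈ b → Top p n a → Top q n b
  top-cong p≋q a≈b t =
    top (trans (sym (at p≋q _)) (trans (leading t) a≈b)) (vanish-cong p≋q (above t))

  top-+ : ∀ {p q n a b} → Top p n a → Top q n b → Top (p +P q) n (a + b)
  top-+ {p} {q} t u =
    top (trans (coeff-+ p q _) (+-cong (leading t) (leading u))) (vanish-+ {p} {q} (above t) (above u))

  top-scale : ∀ a {p n b} → Top p n b → Top (scale a p) n (a * b)
  top-scale a {p} t = top (trans (coeff-scale a p _) (*-cong refl (leading t)))
    (λ k n<k → trans (coeff-scale a p k) (trans (*-cong refl (above t k n<k)) (zeroʳ a)))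

  top-0∷ : ∀ {p n a} → Top p n a → Top (0# ∷ p) (suc n) a
  top-0∷ t = top (leading t) λ where (suc k) (s≤s n<k) → above t k n<k

  -- Induction on `m`. At `m = 0` the tail of `p` is zero and only the scaled copy of `q` survives.
  -- Otherwise that copy has degree at most `n`, below `suc m + n`, and the top coefficient comes
  -- from the shifted product.
  top-* : ∀ {p q} m {n a b} → Top p m a → Top q n b → Top (p *P q) (m ℕ.+ n) (a * b)
  top-* {[]} m {b = b} t u =
    top (sym (trans (*-cong (sym (leading t)) refl) (zeroˡ b))) (λ _ _ → refl)
  top-* {x ∷ p} {q} zero {n} t u = top-cong
    (PR.sym (PR.trans (PR.+-cong (PR.refl {scale x q}) (∷≋[] refl p*q≋[])) (PR.+-identityʳ _)))
    (*-cong (leading t) refl) (top-scale x u)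
    where
    p*q≋[] : (p *P q) ≋ []
    p*q≋[] = PR.trans
      (PR.*-cong {p} {[]} {q} {q} (pointwise λ k → above t (suc k) (s≤s z≤n)) (PR.refl {q})) (PR.zeroˡ q)
  top-* {x ∷ p} {q} (suc m) {n} t u = top-cong PR.refl (+-identityˡ _)
    (top-+ (vanish⇒top (λ k n<k → above (top-scale x u) k (ℕₚ.≤-trans (s≤s (ℕₚ.m≤n+m n m)) n<k)))
           (top-0∷ (top-* {p} {q} m (top (leading t) (λ k m<k → above t (suc k) (s≤s m<k))) u)))

  Monic : Pol → ℕ → Set ℓ
  Monic p n = Top p n 1#

  linear-monic : ∀ t → Monic (linear t) 1
  linear-monic t = top refl λ where
    (suc zero)    (s≤s ())
    (suc (suc k)) _ → refl

  -- Works down from the length of `h`: once `h` vanishes above index `j + n`, its coefficient there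
  -- equals that of `q *P h` at `m + (j + n)`, because `q` is monic, and this one is zero.
  monic-quotient-vanish : ∀ q h {m} n → Monic q m → Vanish (q *P h) (m ℕ.+ n) → Vanish h n
  monic-quotient-vanish q h {m} n q-monic v =
    descend (List.length h) (vanish-mono {h} (ℕₚ.m≤m+n _ n) (vanish-length h))
    where
    descend : ∀ j → Vanish h (j ℕ.+ n) → Vanish h n
    descend zero    w = w
    descend (suc j) w = descend j (top⇒vanish (top-cong PR.refl
      (trans (sym (*-identityˡ _)) (trans (sym (leading (top-* m q-monic (vanish-suc⇒top {h} w))))
        (v _ (ℕₚ.+-monoʳ-≤ m (ℕₚ.m≤n+m n j)))))
      (vanish-suc⇒top {h} w)))

-- Change of coefficients along a ring homomorphism.

module _ {R₁ : RawRing c ℓ} (R₂ : CommutativeRing c′ ℓ′) where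
  private
    module R₁ = RawRing R₁
    module P₁ = Poly R₁
  open CommutativeRing R₂ hiding (zero)
  open PolynomialRing R₂
  open RingMorphisms using (IsRingHomomorphism)

  coeff-map : ∀ {φ} → IsRingHomomorphism R₁ rawRing φ →
              ∀ p k → coeff (map φ p) k ≈ φ (P₁.coeff p k)
  coeff-map φ-hom []      k       = sym (IsRingHomomorphism.0#-homo φ-hom)
  coeff-map φ-hom (a ∷ p) zero    = refl
  coeff-map φ-hom (a ∷ p) (suc k) = coeff-map φ-hom p k

  map-hom : ∀ {φ} → IsRingHomomorphism R₁ rawRing φ → IsRingHomomorphism P₁.rawRingP PR.rawRing (map φ)
  map-hom {φ} φ-hom = RingHom.mkHom P₁.rawRingP polynomialRing (map φ)
    (λ {p} {q} p≈q → pointwise λ k →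
      trans (coeff-map φ-hom p k) (trans (⟦⟧-cong (p≈q k)) (sym (coeff-map φ-hom q k))))
    map-+ map-* map-neg PR.refl (∷-cong 1#-homo PR.refl)
    where
    open IsRingHomomorphism φ-hom

    map-+ : ∀ p q → map φ (p P₁.+P q) ≋ (map φ p +P map φ q)
    map-+ []      q       = PR.refl
    map-+ (a ∷ p) []      = PR.refl
    map-+ (a ∷ p) (b ∷ q) = ∷-cong (+-homo a b) (map-+ p q)

    map-neg : ∀ p → map φ (P₁.-P p) ≋ (-P map φ p)
    map-neg []      = PR.refl
    map-neg (a ∷ p) = ∷-cong (-‿homo a) (map-neg p)

    map-scale : ∀ a p → map φ (map (a R₁.*_) p) ≋ scale (φ a) (map φ p)
    map-scale a []      = PR.refl
    map-scale a (b ∷ p) = ∷-cong (*-homo a b) (map-scale a p)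

    map-* : ∀ p q → map φ (p P₁.*P q) ≋ (map φ p *P map φ q)
    map-* []      q = PR.refl
    map-* (a ∷ p) q = PR.trans (map-+ (map (a R₁.*_) q) _)
      (PR.+-cong (map-scale a q) (∷-cong 0#-homo (map-* p q)))

-- Polynomials over a field: degrees, roots and products of linear factors.

module FieldPolynomial (L : Field c ℓ) where
  open Field L hiding (zero)
  open PolynomialRing commutativeRing
  open RingOps rawRing using () renaming (pow to power)
  open RingOps PR.rawRing

  *-nonzero : ∀ {a b} → ¬ a ≈ 0# → ¬ b ≈ 0# → ¬ a * b ≈ 0#
  *-nonzero {a} {b} a≉0 b≉0 ab≈0 with inverse a a≉0
  ... | u , au≈1 = b≉0 (trans (sym (*-identityˡ b)) (trans (*-cong (trans (sym au≈1) (*-comm a u)) refl)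
    (trans (*-assoc u a b) (trans (*-cong refl ab≈0) (zeroʳ u)))))

  power-nonzero : ∀ {a} n → ¬ a ≈ 0# → ¬ power a n ≈ 0#
  power-nonzero zero    a≉0 = 1≉0
  power-nonzero (suc n) a≉0 = *-nonzero a≉0 (power-nonzero n a≉0)

  HasDegree : Pol → ℕ → Set ℓ
  HasDegree p n = ¬ coeff p n ≈ 0# × Vanish p (suc n)

  top⇒degree : ∀ {p n a} → ¬ a ≈ 0# → Top p n a → HasDegree p n
  top⇒degree a≉0 t = (λ e → a≉0 (trans (sym (leading t)) e)) , above t

  degree-+ : ∀ {p q n} → HasDegree p n → Vanish q n → HasDegree (p +P q) n
  degree-+ {p} {q} (p≉0 , p-above) v = top⇒degree p≉0
    (top-cong PR.refl (+-identityʳ _) (top-+ (vanish-suc⇒top {p} p-above) (vanish⇒top {q} v)))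

  -- The coefficients are tested from the end of the list down to index `n`. Each test is an
  -- instance of excluded middle, hence the double negation.
  degree-dichotomy : ∀ p n → ¬ ¬ (Vanish p n ⊎ ∃ λ k → n ≤ k × HasDegree p k)
  degree-dichotomy p n =
    descend (List.length p) (vanish-mono {p} (ℕₚ.m≤m+n _ n) (vanish-length p))
    where
    descend : ∀ j → Vanish p (j ℕ.+ n) → ¬ ¬ (Vanish p n ⊎ ∃ λ k → n ≤ k × HasDegree p k)
    descend zero    v c = c (inj₁ v)
    descend (suc j) v c = ¬¬-excluded-middle λ where
      (yes e) → descend j (top⇒vanish (top {p} e v)) c
      (no ¬e) → c (inj₂ (j ℕ.+ n , ℕₚ.m≤n+m n j , ¬e , v))

  top-pow : ∀ {p k a} n → Top p k a → Top (pow p n) (n ℕ.* k) (power a n)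
  top-pow     zero    t = top refl λ where (suc k) _ → refl
  top-pow {p} {k} (suc n) t = top-* {p} k t (top-pow n t)

  sumFin-vanish : ∀ m n {g : Fin m → Pol} → (∀ i → Vanish (g i) n) → Vanish (sumFin m g) n
  sumFin-vanish zero    n     v = λ _ _ → refl
  sumFin-vanish (suc m) n {g} v =
    vanish-+ {g Fin.zero} (v Fin.zero) (sumFin-vanish m n (λ i → v (Fin.suc i)))

  sign-vanish : ∀ δ → Vanish ⟦ δ ⟧ˢ 1
  sign-vanish Sign.+ (suc k) _ = refl
  sign-vanish Sign.- (suc k) _ = refl

  sign*-vanish : ∀ δ {p n} → Vanish p n → Vanish (⟦ δ ⟧ˢ *P p) n
  sign*-vanish δ {p} v = top⇒vanish (top-cong PR.refl (zeroʳ _)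
    (top-* {⟦ δ ⟧ˢ} {p} 0 (vanish-suc⇒top {⟦ δ ⟧ˢ} (sign-vanish δ)) (vanish⇒top {p} v)))

  -- The power `x^d` has degree exactly `d * k`, and every other summand stays below it: `δy`
  -- because `deg y < k ≤ d * k`, the terms of `f` because their coefficients have degree less than
  -- `k`.
  degree-henon : ∀ {Coef : Set a} (ι : Coef → Pol) d cs δ {x y} k →
    (∀ i → Vanish (ι (cs i)) k) → HasDegree x k → Vanish y k →
    k ≤ d ℕ.* k → HasDegree ((⟦ δ ⟧ˢ *P y) +P fGen ι d cs x) (d ℕ.* k)
  degree-henon ι d cs δ {x} {y} k cs-vanish (x≉0 , x-above) y-vanish k≤dk =
    top⇒degree (power-nonzero d x≉0) (top-cong PR.refl (trans (+-identityˡ _) (+-identityʳ _))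
      (top-+ (vanish⇒top {⟦ δ ⟧ˢ *P y} (vanish-mono {⟦ δ ⟧ˢ *P y} k≤dk (sign*-vanish δ y-vanish)))
        (top-+ (top-pow d x-top) (vanish⇒top (sumFin-vanish d (d ℕ.* k) term-vanish)))))
    where
    x-top = vanish-suc⇒top {x} x-above

    term-vanish : ∀ i → Vanish (ι (cs i) *P pow x (d ∸ suc (toℕ i))) (d ℕ.* k)
    term-vanish i = vanish-mono {ι (cs i) *P pow x (d ∸ suc (toℕ i))}
      -- The term has degree less than `k + (d ∸ suc i) * k`, that is `suc (d ∸ suc i) * k`, and
      -- `suc (d ∸ suc i) ≤ d`.
      (ℕₚ.*-monoˡ-≤ k (ℕₚ.∸-monoʳ-< {d} (s≤s z≤n) (toℕ<n i)))
      (top⇒vanish (top-cong PR.refl (zeroˡ _)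
        (top-* {ι (cs i)} k (vanish⇒top {ι (cs i)} (cs-vanish i)) (top-pow (d ∸ suc (toℕ i)) x-top))))

  -- `algClosed` accepts only lists that end in a literal `1#`; this rebuilds a monic polynomial in
  -- that shape from its coefficient function.
  monic-coeffs : ∀ (f : ℕ → Carrier) n → f n ≈ 1# → (∀ k → n < k → f k ≈ 0#) →
                 ∀ k → coeff (List.applyUpTo f n List.++ List.[ 1# ]) k ≈ f k
  monic-coeffs f zero    f≈1 f≈0 zero    = sym f≈1
  monic-coeffs f zero    f≈1 f≈0 (suc k) = sym (f≈0 (suc k) (s≤s z≤n))
  monic-coeffs f (suc n) f≈1 f≈0 zero    = refl
  monic-coeffs f (suc n) f≈1 f≈0 (suc k) =
    monic-coeffs (λ j → f (suc j)) n f≈1 (λ j n<j → f≈0 (suc j) (s≤s n<j)) k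

  -- The list depends on `S` and `m` alone, so a common period for its members can be fixed before
  -- choosing the polynomial that one of them must divide.
  linearProducts : List Carrier → ℕ → List Pol
  linearProducts S zero    = C 1# ∷ []
  linearProducts S (suc m) = List.concatMap (λ s → map (linear s *P_) (linearProducts S m)) S

  linearProducts-monic : ∀ S m → All (λ q → Monic q m) (linearProducts S m)
  linearProducts-monic S zero    = top refl (λ where (suc k) _ → refl) ∷ []
  linearProducts-monic S (suc m) = Allₚ.concat⁺ (Allₚ.map⁺ (All.universal (λ s → Allₚ.map⁺
    (All.map (λ {q} q-monic → top-cong PR.refl (*-identityˡ 1#) (top-* {linear s} {q} 1 (linear-monic s) q-monic))
      (linearProducts-monic S m))) S))

  module _ (algClosed : ∀ (as : List Carrier) → 1 ≤ List.length as →
                        ∃ λ x → eval (as List.++ List.[ 1# ]) x ≈ 0#) where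

    root : ∀ p n → HasDegree p (suc n) → ∃ λ t → eval p t ≈ 0#
    root p n (p≉0 , p-above) with inverse (coeff p (suc n)) p≉0
    ... | u , lu≈1 with algClosed (List.applyUpTo (λ k → u * coeff p k) (suc n)) (s≤s z≤n)
    ... | t , e = t , (begin
      eval p t                              ≈⟨ *-identityˡ _ ⟨
      1# * eval p t                         ≈⟨ *-cong lu≈1 refl ⟨
      (coeff p (suc n) * u) * eval p t      ≈⟨ *-assoc _ _ _ ⟩
      coeff p (suc n) * (u * eval p t)      ≈⟨ *-cong refl (eval-scale u p t) ⟨
      coeff p (suc n) * eval (scale u p) t  ≈⟨ *-cong refl (eval-cong monic (scale u p) t monic≋) ⟨
      coeff p (suc n) * eval monic t        ≈⟨ *-cong refl e ⟩
      coeff p (suc n) * 0#                  ≈⟨ zeroʳ _ ⟩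
      0#                                    ∎)
      where
      open import Relation.Binary.Reasoning.Setoid setoid
      monic = List.applyUpTo (λ k → u * coeff p k) (suc n) List.++ List.[ 1# ]
      monic≋ : monic ≋ scale u p
      monic≋ = pointwise λ k → trans
        (monic-coeffs (λ k → u * coeff p k) (suc n) (trans (*-comm _ _) lu≈1)
          (λ j n<j → trans (*-cong refl (p-above j n<j)) (zeroʳ u)) k)
        (sym (coeff-scale u p k))

    -- Splits off one root at a time. The quotient has degree one less and its roots are roots of
    -- `g`, so they still lie in `S`; the degree `m + n` guarantees a root at each of the `m`
    -- rounds.
    linearProducts-divide : ∀ S m n g → HasDegree g (m ℕ.+ n) →
      (∀ t → eval g t ≈ 0# → Any (t ≈_) S) →
      Any (λ q → ∃ λ h → g ≋ (q *P h)) (linearProducts S m)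
    linearProducts-divide S zero    n g deg roots = here (g , PR.sym (PR.*-identityˡ g))
    linearProducts-divide S (suc m) n g (g≉0 , g-above) roots with root g (m ℕ.+ n) (g≉0 , g-above)
    ... | t , gt≈0 with root⇒factor t g gt≈0
    ... | h , g≋ = Anyₚ.concatMap⁺ (λ s → map (linear s *P_) (linearProducts S m)) (Any.map
      -- The root agrees with a member of `S` only up to `≈`, so the factor `linear t` is exchanged
      -- for the listed `linear s`.
      (λ t≈s → Anyₚ.map⁺ (Any.map (λ {q} (k , h≋) → k , PR.trans g≋ (PR.trans
        (PR.*-cong (linear-cong t≈s) h≋) (PR.sym (PR.*-assoc (linear _) q k)))) divides-h))
      (roots t gt≈0))
      where
      h-vanish : Vanish h (suc (m ℕ.+ n))
      h-vanish = monic-quotient-vanish (linear t) h (suc (m ℕ.+ n)) (linear-monic t) (vanish-cong g≋ g-above)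

      h≉0 : ¬ coeff h (m ℕ.+ n) ≈ 0#
      h≉0 e = g≉0 (trans (at g≋ _) (trans
        (leading (top-* {linear t} {h} 1 (linear-monic t) (vanish-suc⇒top {h} h-vanish)))
        (trans (*-identityˡ _) e)))

      divides-h = linearProducts-divide S m n h (h≉0 , h-vanish)
        (λ s hs≈0 → roots s (trans (eval-cong g _ s g≋) (trans (eval-* (linear t) h s)
          (trans (*-cong refl hs≈0) (zeroʳ _)))))

-- Maps with a reversing symmetry.

module Reversible (S : Setoid c ℓ) (H s : Setoid.Carrier S → Setoid.Carrier S)
                  (H-cong : ∀ x y → Setoid._≈_ S x y → Setoid._≈_ S (H x) (H y))
                  (H∘s∘H≈s : ∀ x → Setoid._≈_ S (H (s (H x))) (s x)) where
  open Setoid S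

  private
    fold-shift : ∀ x n → fold x H (suc n) ≡ fold (H x) H n
    fold-shift x zero    = ≡.refl
    fold-shift x (suc n) = ≡.cong H (fold-shift x n)

  fold-cong : ∀ {x y} n → x ≈ y → fold x H n ≈ fold y H n
  fold-cong zero    x≈y = x≈y
  fold-cong (suc n) x≈y = H-cong _ _ (fold-cong n x≈y)

  -- The word collapses from the inside: `H^(n+1) s H^(n+1) = H^n (H s H) H^n = H^n s
  -- H^n`. No inverse of `H` is involved.
  fold-reversed : ∀ x n → fold (s (fold x H n)) H n ≈ s x
  fold-reversed x zero    = refl
  fold-reversed x (suc n) = trans (reflexive (fold-shift (s (fold x H (suc n))) n))
    (trans (fold-cong n (H∘s∘H≈s (fold x H n))) (fold-reversed x n))

  -- `H^n (H^n x) ≈ H^n (s (H^n x)) ≈ s x ≈ x`, where the middle step is `fold-reversed`.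
  symmetric⇒periodic : ∀ x n → s x ≈ x → s (fold x H n) ≈ fold x H n → fold x H (n ℕ.+ n) ≈ x
  symmetric⇒periodic x n sx≈x sHⁿx≈Hⁿx = trans (reflexive (fold-+ x H n))
    (trans (fold-cong n (sym sHⁿx≈Hⁿx)) (trans (fold-reversed x n) sx≈x))

  periodic-* : ∀ x n m → fold x H n ≈ x → fold x H (m ℕ.* n) ≈ x
  periodic-* x n zero    Hⁿx≈x = refl
  periodic-* x n (suc m) Hⁿx≈x =
    trans (reflexive (fold-+ x H n)) (trans (fold-cong n (periodic-* x n m Hⁿx≈x)) Hⁿx≈x)

-- Congruence modulo an element of a ring.

module Congruence (R : CommutativeRing c ℓ) (q : CommutativeRing.Carrier R) where
  open CommutativeRing R hiding (zero)
  open import Algebra.Properties.Ring ring using (-‿distribʳ-*)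
  open import Algebra.Properties.CommutativeSemigroup +-commutativeSemigroup using (interchange)
  open import Algebra.Properties.CommutativeSemigroup *-commutativeSemigroup using (x∙yz≈y∙xz)

  _~_ : Rel Carrier (c ⊔ ℓ)
  x ~ y = ∃ λ h → x ≈ y + q * h

  ≈⇒~ : ∀ {x y} → x ≈ y → x ~ y
  ≈⇒~ x≈y = 0# , trans x≈y (sym (trans (+-cong refl (zeroʳ q)) (+-identityʳ _)))

  ~-refl : ∀ {x} → x ~ x
  ~-refl = ≈⇒~ refl

  ~-sym : ∀ {x y} → x ~ y → y ~ x
  ~-sym (h , x≈) = - h , sym (trans (+-cong x≈ (sym (-‿distribʳ-* q h)))
    (trans (+-assoc _ _ _) (trans (+-cong refl (-‿inverseʳ _)) (+-identityʳ _))))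

  ~-trans : ∀ {x y z} → x ~ y → y ~ z → x ~ z
  ~-trans (h , x≈) (k , y≈) = k + h , trans x≈ (trans (+-cong y≈ refl)
    (trans (+-assoc _ _ _) (+-cong refl (sym (distribˡ q k h)))))

  ~-+-cong : Congruent₂ _~_ _+_
  ~-+-cong (h , x≈) (k , y≈) = h + k , trans (+-cong x≈ y≈)
    (trans (interchange _ _ _ _) (+-cong refl (sym (distribˡ q h k))))

  ~-*-congˡ : ∀ z {x y} → x ~ y → (z * x) ~ (z * y)
  ~-*-congˡ z (h , x≈) = z * h , trans (*-cong refl x≈)
    (trans (distribˡ _ _ _) (+-cong refl (x∙yz≈y∙xz z q h)))

  ~-*-cong : Congruent₂ _~_ _*_
  ~-*-cong {x} {x′} {y} {y′} x~x′ y~y′ = ~-trans (~-*-congˡ x y~y′)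
    (~-trans (≈⇒~ (*-comm x y′)) (~-trans (~-*-congˡ y′ x~x′) (≈⇒~ (*-comm y′ x′))))

  setoid~ : Setoid c (c ⊔ ℓ)
  setoid~ = record { Carrier = Carrier ; _≈_ = _~_
    ; isEquivalence = record { refl = ~-refl ; sym = ~-sym ; trans = ~-trans } }

-- Sign identities and the reversing symmetry of the Hénon map.

module SignedRing (R : CommutativeRing c ℓ) (δ : Sign) where
  open CommutativeRing R hiding (zero)
  open RingOps rawRing using (⟦_⟧ˢ)
  open import Algebra.Properties.Ring ring
    using (-‿distribʳ-*; -‿+-comm; -1*x≈-x; -‿involutive)
  open import Relation.Binary.Reasoning.Setoid setoid

  ε : Carrier
  ε = ⟦ δ ⟧ˢ

  ε*ε≈1 : ε * ε ≈ 1#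
  ε*ε≈1 = go δ
    where
    go : ∀ δ → ⟦ δ ⟧ˢ * ⟦ δ ⟧ˢ ≈ 1#
    go Sign.+ = *-identityˡ 1#
    go Sign.- = trans (-1*x≈-x _) (-‿involutive 1#)

  ε*[ε*x]≈x : ∀ x → ε * (ε * x) ≈ x
  ε*[ε*x]≈x x = trans (sym (*-assoc _ _ _)) (trans (*-cong ε*ε≈1 refl) (*-identityˡ x))

  -- The single quantity `e` measures how far `(x , y)` is from being fixed by `s`: the components
  -- move by `-e` and `-εe`. Both displacements are thus divisible by every divisor of `e`. The
  -- second identity is the first one applied to `y + εx = εe`.
  antisymmetric : ∀ {x y e} → x + ε * y ≈ e → (- (ε * y) ≈ x + - e) × (- (ε * x) ≈ y + - (ε * e))
  antisymmetric {x} {y} {e} x+εy≈e = lemma x+εy≈e , lemma (begin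
    y + ε * x              ≈⟨ +-comm _ _ ⟩
    ε * x + y              ≈⟨ +-cong refl (ε*[ε*x]≈x y) ⟨
    ε * x + ε * (ε * y)    ≈⟨ distribˡ _ _ _ ⟨
    ε * (x + ε * y)        ≈⟨ *-cong refl x+εy≈e ⟩
    ε * e                  ∎)
    where
    lemma : ∀ {u v w} → u + v ≈ w → - v ≈ u + - w
    lemma {u} {v} {w} u+v≈w = sym (begin
      u + - w          ≈⟨ +-cong refl (-‿cong u+v≈w) ⟨
      u + - (u + v)    ≈⟨ +-cong refl (-‿+-comm u v) ⟨
      u + (- u + - v)  ≈⟨ +-assoc _ _ _ ⟨
      (u + - u) + - v  ≈⟨ +-cong (-‿inverseʳ u) refl ⟩
      0# + - v         ≈⟨ +-identityˡ _ ⟩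
      - v              ∎)

  module _ (f : Carrier → Carrier) (f-cong : ∀ {x y} → x ≈ y → f x ≈ f y)
           (f-sym : ∀ x → f (- (ε * x)) ≈ f x) where

    -- The first component of `H ∘ s ∘ H = s`; the second one holds by computation. By the symmetry
    -- of `f` the two occurrences of `f x` cancel.
    henon-reversed : ∀ x y → ε * - (ε * (ε * y + f x)) + f (- (ε * x)) ≈ - (ε * y)
    henon-reversed x y = begin
      ε * - (ε * (ε * y + f x)) + f (- (ε * x))  ≈⟨ +-cong (sym (-‿distribʳ-* _ _)) (f-sym x) ⟩
      - (ε * (ε * (ε * y + f x))) + f x          ≈⟨ +-cong (-‿cong (ε*[ε*x]≈x _)) refl ⟩
      - (ε * y + f x) + f x                      ≈⟨ +-cong (-‿+-comm _ _) refl ⟨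
      (- (ε * y) + - f x) + f x                  ≈⟨ +-assoc _ _ _ ⟩
      - (ε * y) + (- f x + f x)                  ≈⟨ +-cong refl (-‿inverseˡ _) ⟩
      - (ε * y) + 0#                             ≈⟨ +-identityʳ _ ⟩
      - (ε * y)                                  ∎

    -- On reflected values, one step of the backward recurrence is the reflection of a forward step.
    -- This links the sequence `B` to `A`.
    henon-backward : ∀ {x y u v} → u ≈ - (ε * x) → v ≈ - (ε * y) →
                     ε * (u + - f v) ≈ - (ε * (ε * x + f y))
    henon-backward {x} {y} {u} {v} u≈ v≈ = begin
      ε * (u + - f v)           ≈⟨ *-cong refl (+-cong u≈ (-‿cong (trans (f-cong v≈) (f-sym y)))) ⟩
      ε * (- (ε * x) + - f y)   ≈⟨ *-cong refl (-‿+-comm _ _) ⟩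
      ε * - (ε * x + f y)       ≈⟨ -‿distribʳ-* _ _ ⟨
      - (ε * (ε * x + f y))     ∎

-- Common multiples of periods.

-- Whether `q` has a period at all is settled by excluded middle, once per list member. Writing
-- periods as successors keeps them positive; a member without a period meets the condition
-- vacuously.
commonMultiple : ∀ {A : Set a} (P : A → ℕ → Set p) → (∀ q m n → P q n → P q (m ℕ.* n)) →
  ∀ qs → ¬ ¬ ∃ λ l → All (λ q → ∀ m → P q (suc m) → P q (suc l)) qs
commonMultiple P P-* []       c = c (0 , [])
commonMultiple P P-* (q ∷ qs) c = commonMultiple P P-* qs λ (l , all) →
  ¬¬-excluded-middle {A = ∃ λ m → P q (suc m)} λ where
    -- The successor of this witness is `suc m * suc l`, a multiple both of the new period and of
    -- the previous common one.
    (yes (m , Pm)) → c (l ℕ.+ m ℕ.* suc l ,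
      (λ _ _ → ≡.subst (P q) (ℕₚ.*-comm (suc l) (suc m)) (P-* q (suc l) (suc m) Pm))
      ∷ All.map (λ {r} h n Pn → P-* r (suc m) (suc l) (h n Pn)) all)
    (no ¬P) → c (l , (λ m Pm → contradiction (m , Pm) ¬P) ∷ all)

-- The orbit of `P` with coordinates in `K̄[t]`.

module _ {K : Field c ℓ} (Kbar : AlgebraicClosure K c′ ℓ′) (d : ℕ) (cs : Fin d → Setting.K[t] K) where
  open AlgebraicClosure Kbar
  private
    module K = Setting K
    module KF = Field K
    module LF = Field L
  open PolynomialRing LF.commutativeRing
  open FieldPolynomial L
  open RingOps PR.rawRing
  open RingMorphisms using (IsRingHomomorphism)
  open import Algebra.Properties.Ring PR.ring using (-1*x≈-x; -‿involutive)

  φ : K.K[t] → Pol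
  φ = map ι

  φ-hom : IsRingHomomorphism K.K[t]-rawRing PR.rawRing φ
  φ-hom = map-hom LF.commutativeRing ι-isRingHom
  private module φ = IsRingHomomorphism φ-hom

  f : Pol → Pol
  f = fGen φ d cs

  private
    module ≋-Cong = FGenCong PR.rawRing _≋_ PR.refl
      (λ {p} {p′} {q} {q′} → PR.+-cong {p} {p′} {q} {q′})
      (λ {p} {p′} {q} {q′} → PR.*-cong {p} {p′} {q} {q′})

  f-cong : ∀ {x y} → x ≋ y → f x ≋ f y
  f-cong = ≋-Cong.fGen-cong {ι = φ} d cs (λ _ → PR.refl)

  -- Evenness is an identity in `K[t][x]`. The homomorphism `ψ`, which extends the coefficients
  -- along `φ` and then substitutes `x` for the variable, carries it over to values.
  f-even : K.IsEvenInX d cs → ∀ x → f (-P x) ≋ f x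
  f-even even x = begin
    f (-P x)
      ≈⟨ ≋-Cong.fGen-cong d cs ψC≋φ ψ-X ⟨
    fGen (λ k → ψ (K.KtX.C k)) d cs (ψ (K.KtX.-P K.KtX.X))
      ≈⟨ fGen-homo ψ-hom K.KtX.C d cs (K.KtX.-P K.KtX.X) ⟨
    ψ (K.fKtX-neg d cs)
      ≈⟨ ψ.⟦⟧-cong {K.fKtX-neg d cs} {K.fKtX d cs} even ⟩
    ψ (K.fKtX d cs)
      ≈⟨ fGen-homo ψ-hom K.KtX.C d cs K.KtX.X ⟩
    fGen (λ k → ψ (K.KtX.C k)) d cs (ψ K.KtX.X)
      ≈⟨ ≋-Cong.fGen-cong d cs ψC≋φ ψX ⟩
    f x ∎
    where
    open import Relation.Binary.Reasoning.Setoid PR.setoid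
    open RingHom K.KtX.rawRingP polynomialRing using (fGen-homo)
    module PX = PolynomialRing polynomialRing

    ψ : K.KtX.Pol → Pol
    ψ p = PX.eval (map φ p) x

    ψ-hom : IsRingHomomorphism K.KtX.rawRingP PR.rawRing ψ
    ψ-hom = isRingHomomorphism PR.trans (map-hom polynomialRing φ-hom) (PX.eval-hom x)
    module ψ = IsRingHomomorphism ψ-hom

    ψC≋φ : ∀ k → ψ (K.KtX.C k) ≋ φ k
    ψC≋φ k = PX.eval-C (φ k) x

    ψX : ψ K.KtX.X ≋ x
    ψX = PR.trans (PX.eval-cong (map φ K.KtX.X) PX.X x
                    (PX.∷-cong PR.refl (PX.∷-cong φ.1#-homo PX.PR.refl)))
                  (PX.eval-X x)

    ψ-X : ψ (K.KtX.-P K.KtX.X) ≋ (-P x)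
    ψ-X = PR.trans (ψ.-‿homo K.KtX.X) (PR.-‿cong ψX)

  -- For `δ = 1` this is evenness; for `δ = -1` the argument `-δx` is `x` itself.
  f-symmetric : ∀ δ → (δ ≡ Sign.+ → K.IsEvenInX d cs) → ∀ x → f (-P (⟦ δ ⟧ˢ *P x)) ≋ f x
  f-symmetric Sign.+ even x = PR.trans (f-cong (PR.-‿cong (PR.*-identityˡ x))) (f-even (even ≡.refl) x)
  f-symmetric Sign.- even x = f-cong (PR.trans (PR.-‿cong (-1*x≈-x x)) (-‿involutive x))

  coeff-bound : ∃ λ D → ∀ i → Vanish (φ (cs i)) D
  coeff-bound = go d cs
    where
    go : ∀ n (ks : Fin n → K.K[t]) → ∃ λ D → ∀ i → Vanish (φ (ks i)) D
    go zero    ks = 0 , λ ()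
    go (suc n) ks with go n (λ i → ks (Fin.suc i))
    ... | D , v = List.length (φ (ks Fin.zero)) ℕ.+ D , λ where
      Fin.zero    → vanish-mono {φ (ks Fin.zero)} (ℕₚ.m≤m+n _ D) (vanish-length (φ (ks Fin.zero)))
      (Fin.suc i) → vanish-mono {φ (ks (Fin.suc i))} (ℕₚ.m≤n+m D _) (v i)

  module _ (2≤d : 2 ≤ d) (δ : Sign) (δ-even : δ ≡ Sign.+ → K.IsEvenInX d cs) (a b : K.K[t])
           (εa+b≈0 : ((K.C (RingOps.⟦_⟧ˢ KF.rawRing δ) K.*P a) K.+P b) K.≈K[t] []) where
    open SignedRing polynomialRing δ

    henon : Pol × Pol → Pol × Pol
    henon (x , y) = (ε *P y) +P f x , x

    orbit : ℕ → Pol × Pol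
    orbit = fold (φ a , φ b) henon

    reflect : Pol × Pol → Pol × Pol
    reflect (x , y) = -P (ε *P y) , -P (ε *P x)

    eval-orbit : ∀ t n →
      let (u , v) = iter (H δ d cs t) n (evalAt a t , evalAt b t) in
      (eval (proj₁ (orbit n)) t ≈̄ u) × (eval (proj₂ (orbit n)) t ≈̄ v)
    eval-orbit t zero    = LF.refl , LF.refl
    eval-orbit t (suc n) with orbit n | eval-orbit t n
    ... | x , y | x≈ , y≈ =
        LF.trans (eval-+ (ε *P y) (f x) t) (LF.+-cong
          (LF.trans (eval-* ε y t) (LF.*-cong (sign-homo (eval-hom t) δ) y≈))
          (LF.trans (fGen-homo (eval-hom t) φ d cs x)
            (FGenCong.fGen-cong LF.rawRing LF._≈_ LF.refl LF.+-cong LF.*-cong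
              {ι = λ k → evalAt k t} d cs (λ _ → LF.refl) x≈)))
      , x≈
      where open RingHom PR.rawRing LF.commutativeRing using (sign-homo; fGen-homo)

    private
      reflect-start : (-P (ε *P φ a) ≋ φ b) × (-P (ε *P φ b) ≋ φ a)
      -- With `e = 0` both displacements vanish, so the starting point is fixed by `s` exactly and
      -- not only modulo some `q`.
      reflect-start with antisymmetric {φ b} {φ a} {[]} (PR.trans (PR.+-comm (φ b) (ε *P φ a)) εφa+φb≋0)
        where
        K-sign : ∀ δ → φ (K.C (RingOps.⟦_⟧ˢ KF.rawRing δ)) ≋ ⟦ δ ⟧ˢ
        K-sign Sign.+ = φ.1#-homo
        K-sign Sign.- = ∷-cong (RingHom.sign-homo KF.rawRing LF.commutativeRing ι-isRingHom Sign.-) PR.refl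

        εφa+φb≋0 : ((ε *P φ a) +P φ b) ≋ []
        εφa+φb≋0 = PR.trans (PR.sym (PR.trans (φ.+-homo (K.C (RingOps.⟦_⟧ˢ KF.rawRing δ) K.*P a) b)
          (PR.+-cong {_} {_} {φ b} (PR.trans (φ.*-homo (K.C (RingOps.⟦_⟧ˢ KF.rawRing δ)) a)
            (PR.*-cong {_} {_} {φ a} (K-sign δ) PR.refl)) PR.refl)))
          (φ.⟦⟧-cong {_} {[]} εa+b≈0)
      ... | -εa≋ , -εb≋ =
          PR.trans -εa≋ (PR.+-identityʳ (φ b))
        , PR.trans -εb≋ (PR.trans (PR.+-cong {φ a} PR.refl (PR.-‿cong (PR.zeroʳ ε))) (PR.+-identityʳ (φ a)))

      φ-henon : ∀ x y → φ ((RingOps.⟦_⟧ˢ K.K[t]-rawRing δ K.*P y) K.+P (K.fK[t] d cs x)) ≋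
                ((ε *P φ y) +P f (φ x))
      φ-henon x y = PR.trans (φ.+-homo (RingOps.⟦_⟧ˢ K.K[t]-rawRing δ K.*P y) (K.fK[t] d cs x))
        (PR.+-cong (PR.trans (φ.*-homo (RingOps.⟦_⟧ˢ K.K[t]-rawRing δ) y)
                     (PR.*-cong {_} {_} {φ y} (sign-homo φ-hom δ) PR.refl))
                   (fGen-homo φ-hom (λ k → k) d cs x))
        where open RingHom K.K[t]-rawRing polynomialRing using (sign-homo; fGen-homo)

      φ-henon⁻¹ : ∀ x y → φ (RingOps.⟦_⟧ˢ K.K[t]-rawRing δ K.*P (x K.+P (K.-P K.fK[t] d cs y))) ≋
                  (ε *P (φ x +P (-P f (φ y))))
      φ-henon⁻¹ x y = PR.trans (φ.*-homo (RingOps.⟦_⟧ˢ K.K[t]-rawRing δ) (x K.+P (K.-P K.fK[t] d cs y)))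
        (PR.*-cong (sign-homo φ-hom δ) (PR.trans (φ.+-homo x (K.-P K.fK[t] d cs y))
          (PR.+-cong {φ x} PR.refl (PR.trans (φ.-‿homo (K.fK[t] d cs y))
            (PR.-‿cong (fGen-homo φ-hom (λ k → k) d cs y))))))
        where open RingHom K.K[t]-rawRing polynomialRing using (sign-homo; fGen-homo)

      f-sym : ∀ x → f (-P (ε *P x)) ≋ f x
      f-sym = f-symmetric δ δ-even

    -- Two consecutive indices are carried because the recursion for `A` has depth two.
    A-orbit : ∀ n → (φ (K.A δ d cs a b n) ≋ proj₁ (orbit n)) ×
                    (φ (K.A δ d cs a b (suc n)) ≋ proj₁ (orbit (suc n)))
    A-orbit zero    = PR.refl , φ-henon a b
    A-orbit (suc n) with A-orbit n
    ... | An≋ , An+1≋ = An+1≋ ,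
      PR.trans (φ-henon (K.A δ d cs a b (suc n)) (K.A δ d cs a b n))
        (PR.+-cong (PR.*-cong {ε} PR.refl An≋) (f-cong An+1≋))

    -- The starting point is fixed by `s`, and `s` exchanges forward and backward orbits, so
    -- `B_n = -δ A_n`. Unbounded degrees of `B` therefore mean unbounded degrees of `A`.
    B-orbit : ∀ n → (φ (K.B δ d cs a b n) ≋ (-P (ε *P proj₁ (orbit n)))) ×
                    (φ (K.B δ d cs a b (suc n)) ≋ (-P (ε *P proj₁ (orbit (suc n)))))
    B-orbit zero    = PR.sym (proj₁ reflect-start) ,
      PR.trans (φ-henon⁻¹ a b) (henon-backward f f-cong f-sym
        (PR.sym (proj₂ reflect-start)) (PR.sym (proj₁ reflect-start)))
    B-orbit (suc n) with B-orbit n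
    ... | Bn≋ , Bn+1≋ = Bn+1≋ ,
      PR.trans (φ-henon⁻¹ (K.B δ d cs a b n) (K.B δ d cs a b (suc n)))
        (henon-backward f f-cong f-sym Bn≋ Bn+1≋)

    module _ (q : Pol) where
      open Congruence polynomialRing q

      pairs~ : Setoid _ _
      pairs~ = ×-setoid setoid~ setoid~

      private
        henon-cong : ∀ z w → Setoid._≈_ pairs~ z w → Setoid._≈_ pairs~ (henon z) (henon w)
        henon-cong (x , y) (x′ , y′) (x~x′ , y~y′) =
            ~-+-cong {ε *P y} {ε *P y′} {f x} {f x′} (~-*-congˡ ε {y} {y′} y~y′)
              (FGenCong.fGen-cong PR.rawRing _~_ (λ {x} → ~-refl {x})
                (λ {x} {x′} {y} {y′} → ~-+-cong {x} {x′} {y} {y′})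
                (λ {x} {x′} {y} {y′} → ~-*-cong {x} {x′} {y} {y′})
                {ι = φ} d cs (λ k → ~-refl {φ k}) x~x′)
          , x~x′

        henon-reflect : ∀ z → Setoid._≈_ pairs~ (henon (reflect (henon z))) (reflect z)
        henon-reflect (x , y) = ≈⇒~ (henon-reversed f f-cong f-sym x y) , ≈⇒~ PR.refl

      open Reversible pairs~ henon reflect henon-cong henon-reflect public
        using (periodic-*; fold-cong; symmetric⇒periodic)

      PeriodMod : ℕ → Set (c′ ⊔ ℓ′)
      PeriodMod n = Setoid._≈_ pairs~ (orbit n) (orbit 0)

      divides⇒periodMod : ∀ n → ∃ (λ h → (proj₁ (orbit n) +P (ε *P proj₂ (orbit n))) ≋ (q *P h)) →
                          PeriodMod (n ℕ.+ n)
      divides⇒periodMod n (h , e≋) with antisymmetric e≋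
      ... | -εy≋ , -εx≋ = symmetric⇒periodic (orbit 0) n
        (≈⇒~ (proj₂ reflect-start) , ≈⇒~ (proj₁ reflect-start))
        -- The quotients `-h` and `-εh` come from the displacements `-e` and `-εe` with `e = q h`.
        ((-P h , PR.trans -εy≋ (PR.+-cong PR.refl (-‿distribʳ-* q h))) ,
         (-P (ε *P h) , PR.trans -εx≋ (PR.+-cong PR.refl
           (PR.trans (PR.-‿cong (x∙yz≈y∙xz ε q h)) (-‿distribʳ-* q (ε *P h))))))
        where
        open import Algebra.Properties.Ring PR.ring using (-‿distribʳ-*)
        open import Algebra.Properties.CommutativeSemigroup PR.*-commutativeSemigroup using (x∙yz≈y∙xz)

    -- Congruence modulo `X - t` forces equality of values at `t`, and evaluation at `t` turns the
    -- orbit over `K̄[t]` into that of `P_t`. The bound on `n` makes the period `n + n` positive.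
    root⇒Periodic : ∀ n t → 1 ≤ n → eval (proj₁ (orbit n) +P (ε *P proj₂ (orbit n))) t ≈̄ LF.0# →
                    Periodic δ d cs a b t
    root⇒Periodic n t 1≤n et≈0 =
        n ℕ.+ n , ℕₚ.≤-trans 1≤n (ℕₚ.m≤m+n n n)
      , LF.trans (LF.sym (proj₁ eval≈)) (eval-~ (proj₁ (orbit (n ℕ.+ n))) (φ a) (proj₁ period))
      , LF.trans (LF.sym (proj₂ eval≈)) (eval-~ (proj₂ (orbit (n ℕ.+ n))) (φ b) (proj₂ period))
      where
      period : PeriodMod (linear t) (n ℕ.+ n)
      period = divides⇒periodMod (linear t) n
        (root⇒factor t (proj₁ (orbit n) +P (ε *P proj₂ (orbit n))) et≈0)
      eval≈ = eval-orbit t (n ℕ.+ n)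
      open Congruence polynomialRing (linear t) using (_~_)
      eval-~ : ∀ x y → x ~ y → eval x t ≈̄ eval y t
      eval-~ x y (h , x≋) = LF.trans (eval-cong x (y +P (linear t *P h)) t x≋)
        (LF.trans (eval-+ y (linear t *P h) t) (LF.trans
          (LF.+-cong LF.refl (LF.trans (eval-* (linear t) h t)
            (LF.trans (LF.*-cong (eval-linear t) LF.refl) (LF.zeroˡ _))))
          (LF.+-identityʳ _)))

    -- Growth of degrees along the orbit.

    module Growth (N : ℕ) (1≤N : 1 ≤ N) (cs-vanish : ∀ i → Vanish (φ (cs i)) N)
                  (a-vanish : Vanish (φ a) N) (b-vanish : Vanish (φ b) N) where

      -- A region that the map preserves: inside it `x^d` outweighs all other terms, so each step
      -- multiplies the degree of the first component by `d`.
      Dominated : ℕ → Pol × Pol → Set ℓ′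
      Dominated k (x , y) = N ≤ k × HasDegree x k × Vanish y k

      k<d*k : ∀ {k} → N ≤ k → k < d ℕ.* k
      k<d*k {k} N≤k = ℕₚ.≤-trans (ℕₚ.+-monoˡ-≤ k (ℕₚ.≤-trans 1≤N N≤k))
        (ℕₚ.≤-trans (ℕₚ.≤-reflexive (≡.cong (k ℕ.+_) (≡.sym (ℕₚ.+-identityʳ k))))
          (ℕₚ.*-monoˡ-≤ k 2≤d))

      dominated-henon : ∀ {k} z → Dominated k z → Dominated (d ℕ.* k) (henon z)
      dominated-henon {k} (x , y) (N≤k , x-deg , y-vanish) =
          ℕₚ.≤-trans N≤k (ℕₚ.<⇒≤ (k<d*k N≤k))
        , degree-henon φ d cs δ {x} {y} k
            (λ i → vanish-mono {φ (cs i)} N≤k (cs-vanish i)) x-deg y-vanish (ℕₚ.<⇒≤ (k<d*k N≤k))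
        , vanish-mono {x} (k<d*k N≤k) (proj₂ x-deg)

      dominated-later : ∀ {m n k} → m ≤ n → Dominated k (orbit m) → ∃ λ k′ → Dominated k′ (orbit n)
      dominated-later {m} {n} {k} m≤n dom =
        ≡.subst (λ i → ∃ λ k′ → Dominated k′ (orbit i)) (ℕₚ.m∸n+n≡m m≤n) (go (n ∸ m))
        where
        go : ∀ j → ∃ λ k′ → Dominated k′ (orbit (j ℕ.+ m))
        go zero    = k , dom
        go (suc j) = d ℕ.* proj₁ (go j) , dominated-henon (orbit (j ℕ.+ m)) (proj₂ (go j))

      -- At the first index where the first component reaches degree `N`, the second component,
      -- being the previous first one or `b`, still has degree below `N`; the pair is then
      -- dominated.
      search : ∀ n → ¬ ¬ ((∃ λ m → ∃ λ k → Dominated k (orbit m)) ⊎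
                          (Vanish (proj₁ (orbit n)) N × Vanish (proj₂ (orbit n)) N))
      search zero    c = c (inj₂ (a-vanish , b-vanish))
      search (suc n) c = search n λ where
        (inj₁ dom) → c (inj₁ dom)
        (inj₂ (x-vanish , y-vanish)) → degree-dichotomy (proj₁ (orbit (suc n))) N λ where
          (inj₁ v) → c (inj₂ (v , x-vanish))
          (inj₂ (k , N≤k , deg)) →
            c (inj₁ (suc n , k , N≤k , deg , vanish-mono {proj₁ (orbit n)} N≤k x-vanish))

    -- The contradiction with a finite cover of `Σ(P)`.

    unbounded⇒SigmaInfinite : (∀ N → ∃ λ n → ¬ Vanish (proj₁ (orbit n)) N) → SigmaInfinite δ d cs a b
    -- The goal is `⊥`, so the double negations are eliminated by application. The choice of `n₀`
    -- excludes the alternative in which the degree stays below `N`.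
    unbounded⇒SigmaInfinite unbounded (S , covers) = search n₀ λ where
        (inj₂ (v , _)) → ¬v v
        (inj₁ (m , k , dom)) → commonMultiple PeriodMod
          (λ q m n → periodic-* q (orbit 0) n m) (linearProducts S M) λ (l , periods) →
          no-cover m k dom l periods
      where
      x₂-x₀ = proj₁ (orbit 2) +P (-P φ a)
      y₂-y₀ = proj₂ (orbit 2) +P (-P φ b)
      M = List.length x₂-x₀ ℕ.+ List.length y₂-y₀
      D = proj₁ coeff-bound
      -- Large enough to bound the coefficients of `f` and both starting entries, and to give every
      -- dominated pair degree at least `M`; the successor makes `N` positive.
      N = suc (M ℕ.+ (D ℕ.+ (List.length (φ a) ℕ.+ List.length (φ b))))

      D≤N : D ≤ N
      D≤N = ℕₚ.m≤n⇒m≤1+n (ℕₚ.≤-trans (ℕₚ.m≤m+n D _) (ℕₚ.m≤n+m _ M))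
      a≤N : List.length (φ a) ≤ N
      a≤N = ℕₚ.m≤n⇒m≤1+n (ℕₚ.≤-trans (ℕₚ.m≤m+n _ _) (ℕₚ.≤-trans (ℕₚ.m≤n+m _ D) (ℕₚ.m≤n+m _ M)))
      b≤N : List.length (φ b) ≤ N
      b≤N = ℕₚ.m≤n⇒m≤1+n (ℕₚ.≤-trans (ℕₚ.m≤n+m _ (List.length (φ a)))
        (ℕₚ.≤-trans (ℕₚ.m≤n+m _ D) (ℕₚ.m≤n+m _ M)))

      open Growth N (s≤s z≤n) (λ i → vanish-mono {φ (cs i)} D≤N (proj₂ coeff-bound i))
        (vanish-mono {φ a} a≤N (vanish-length (φ a))) (vanish-mono {φ b} b≤N (vanish-length (φ b)))

      n₀ = proj₁ (unbounded N)
      ¬v = proj₂ (unbounded N)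

      -- The monic `q` of degree `M` divides `x - y`, whose degree is less than `M`, so the quotient
      -- is zero.
      congruent⇒equal : ∀ q x y → Monic q M → Vanish (x +P (-P y)) M →
                        Congruence._~_ polynomialRing q x y → x ≋ y
      congruent⇒equal q x y q-monic v (h , x≋) = PR.trans x≋ (PR.trans
        (PR.+-cong PR.refl (PR.trans (PR.*-cong {q} PR.refl h≋[]) (PR.zeroʳ q))) (PR.+-identityʳ y))
        where
        x-y≋ : (x +P (-P y)) ≋ (q *P h)
        x-y≋ = PR.trans (PR.+-cong x≋ PR.refl) (xyx⁻¹≈y y (q *P h))
          where open import Algebra.Properties.AbelianGroup PR.+-abelianGroup using (xyx⁻¹≈y)
        h≋[] : h ≋ []
        h≋[] = pointwise λ k → monic-quotient-vanish q h 0 q-monic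
          (≡.subst (Vanish (q *P h)) (≡.sym (ℕₚ.+-identityʳ M)) (vanish-cong x-y≋ v)) k z≤n

      -- A congruence `Q_2 ≡ Q_0` would be an equality and make the whole orbit 2-periodic, yet from
      -- the dominated index `m` to `m + 2` the degree rises from `k` to `d * (d * k)`.
      ¬period₂ : ∀ {q m k} → Monic q M → Dominated k (orbit m) → ¬ PeriodMod q 2
      ¬period₂ {q} {m} {k} q-monic dom (x~ , y~) = proj₁ (proj₁ (proj₂ dom₂)) (LF.trans
          (LF.sym (at (proj₁ orbit≋) _)) (proj₂ (proj₁ (proj₂ dom)) _
            (ℕₚ.≤-trans (k<d*k (proj₁ dom)) (ℕₚ.<⇒≤ (k<d*k (proj₁ dom₁))))))
        where
        dom₁ = dominated-henon (orbit m) dom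
        dom₂ = dominated-henon (orbit (suc m)) dom₁
        orbit₂≋ : (proj₁ (orbit 2) ≋ φ a) × (proj₂ (orbit 2) ≋ φ b)
        orbit₂≋ = congruent⇒equal q (proj₁ (orbit 2)) (φ a) q-monic
                    (vanish-mono {x₂-x₀} (ℕₚ.m≤m+n _ _) (vanish-length x₂-x₀)) x~
                , congruent⇒equal q (proj₂ (orbit 2)) (φ b) q-monic
                    (vanish-mono {y₂-y₀} (ℕₚ.m≤n+m _ (List.length x₂-x₀)) (vanish-length y₂-y₀)) y~
        shift : ∀ n → (proj₁ (orbit n) ≋ proj₁ (orbit (suc (suc n)))) ×
                      (proj₂ (orbit n) ≋ proj₂ (orbit (suc (suc n))))
        shift zero    = PR.sym (proj₁ orbit₂≋) , PR.sym (proj₂ orbit₂≋)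
        shift (suc n) with shift n
        ... | x≋ , y≋ = PR.+-cong (PR.*-cong {ε} PR.refl y≋) (f-cong x≋) , x≋
        orbit≋ = shift m

      no-cover : ∀ m k → Dominated k (orbit m) → ∀ l →
               All (λ q → ∀ n → PeriodMod q (suc n) → PeriodMod q (suc l)) (linearProducts S M) → ⊥
      no-cover m k dom l periods = All.lookupWith
        (λ {q} (q-monic , period) (h , e≋) → ¬period₂ {q} {m} q-monic dom (period₂ q period (h , e≋)))
        (All.zip (linearProducts-monic S M , periods)) divisor
        where
        -- Congruent to 1 modulo the common period `suc l`, so that `n + n` is congruent to 2, and
        -- at least `m`, so that `orbit n` is dominated.
        n = suc (m ℕ.* suc l)
        e = proj₁ (orbit n) +P (ε *P proj₂ (orbit n))

        later : ∃ λ k′ → Dominated k′ (orbit n)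
        later = dominated-later {m} {n} (ℕₚ.m≤n⇒m≤1+n (ℕₚ.m≤m*n m (suc l))) dom
        k′ = proj₁ later

        M≤k′ : M ≤ k′
        M≤k′ = ℕₚ.≤-trans (ℕₚ.m≤n⇒m≤1+n (ℕₚ.m≤m+n M _)) (proj₁ (proj₂ later))

        e-degree : HasDegree e k′
        e-degree = degree-+ {proj₁ (orbit n)} {ε *P proj₂ (orbit n)} (proj₁ (proj₂ (proj₂ later)))
          (sign*-vanish δ {proj₂ (orbit n)} (proj₂ (proj₂ (proj₂ later))))

        divisor : Any (λ q → ∃ λ h → e ≋ (q *P h)) (linearProducts S M)
        divisor = linearProducts-divide algClosed S M (k′ ∸ M) e
          (≡.subst (HasDegree e) (≡.sym (ℕₚ.m+[n∸m]≡n M≤k′)) e-degree)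
          (λ t et≈0 → covers t (root⇒Periodic n t (s≤s z≤n) et≈0))

        n+n≡ : n ℕ.+ n ≡ 2 ℕ.+ (m ℕ.+ m) ℕ.* suc l
        n+n≡ = ≡.cong suc (≡.trans (ℕₚ.+-suc (m ℕ.* suc l) (m ℕ.* suc l))
          (≡.cong suc (≡.sym (ℕₚ.*-distribʳ-+ (suc l) m m))))

        period₂ : ∀ q → (∀ j → PeriodMod q (suc j) → PeriodMod q (suc l)) →
                  ∃ (λ h → e ≋ (q *P h)) → PeriodMod q 2
        period₂ q period q∣e = q~.trans {orbit 2} {orbit (2 ℕ.+ (m ℕ.+ m) ℕ.* suc l)} {orbit 0}
          (q~.sym {orbit (2 ℕ.+ (m ℕ.+ m) ℕ.* suc l)} {orbit 2}
            (fold-cong q {orbit ((m ℕ.+ m) ℕ.* suc l)} {orbit 0} 2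
              -- `n + n` computes to `suc (m * suc l + n)`, a positive period, so `period` yields
              -- `suc l`. Its multiple `(m + m) * suc l` is what `n + n` exceeds by 2.
              (periodic-* q (orbit 0) (suc l) (m ℕ.+ m) (period (m ℕ.* suc l ℕ.+ n) period-n+n))))
          (≡.subst (PeriodMod q) n+n≡ period-n+n)
          where
          module q~ = Setoid (pairs~ q)
          period-n+n : PeriodMod q (n ℕ.+ n)
          period-n+n = divides⇒periodMod q n q∣e

    -- Transfer of the degree hypothesis from `K[t]` to `K̄[t]`.

    -- A homomorphism of fields keeps nonzero elements nonzero: with `u` inverse to the coefficient,
    -- a zero image would give `1 = 0` in `K̄`.
    nonzero⇒¬Vanish : ∀ {N k p q} → φ p ≋ q → N ≤ k → ¬ K.coeffK p k KF.≈ KF.0# → ¬ Vanish q N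
    nonzero⇒¬Vanish {N} {k} {p} {q} φp≋q N≤k pₖ≉0 v with KF.inverse (K.coeffK p k) pₖ≉0
    ... | u , pₖu≈1 = LF.1≉0 (begin
      LF.1#                       ≈⟨ ι.1#-homo ⟨
      ι KF.1#                     ≈⟨ ι.⟦⟧-cong pₖu≈1 ⟨
      ι (K.coeffK p k KF.* u)     ≈⟨ ι.*-homo (K.coeffK p k) u ⟩
      ι (K.coeffK p k) LF.* ι u   ≈⟨ LF.*-cong (coeff-map LF.commutativeRing ι-isRingHom p k) LF.refl ⟨
      coeff (φ p) k LF.* ι u      ≈⟨ LF.*-cong (LF.trans (at φp≋q k) (v k N≤k)) LF.refl ⟩
      LF.0# LF.* ι u              ≈⟨ LF.zeroˡ (ι u) ⟩
      LF.0#                       ∎)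
      where
      open import Relation.Binary.Reasoning.Setoid LF.setoid
      module ι = IsRingHomomorphism ι-isRingHom

    orbit-unbounded : K.DegUnbounded (K.A δ d cs a b) ⊎ K.DegUnbounded (K.B δ d cs a b) →
                      ∀ N → ∃ λ n → ¬ Vanish (proj₁ (orbit n)) N
    orbit-unbounded (inj₁ unbounded) N with unbounded N
    ... | n , k , N≤k , Aₙₖ≉0 = n , nonzero⇒¬Vanish (proj₁ (A-orbit n)) N≤k Aₙₖ≉0
    orbit-unbounded (inj₂ unbounded) N with unbounded N
    -- Since `B_n = -δ A_n`, a bound on the degree of `A_n` would pass to `B_n`.
    ... | n , k , N≤k , Bₙₖ≉0 = n , λ v → nonzero⇒¬Vanish (proj₁ (B-orbit n)) N≤k Bₙₖ≉0
      (λ j N≤j → LF.trans (coeff-neg (ε *P proj₁ (orbit n)) j)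
        (LF.trans (LF.-‿cong (sign*-vanish δ {proj₁ (orbit n)} v j N≤j)) -0#≈0#))
      where open import Algebra.Properties.Ring LF.ring using (-0#≈0#)

theorem5p1 : ∀ {c ℓ c' ℓ' : Level} (K : Field c ℓ) (d : ℕ) → 2 ≤ d →
    (δ : Sign) (cs : Fin d → Setting.K[t] K) →
    (δ ≡ Sign.+ → Setting.IsEvenInX K d cs) →
    (a b : Setting.K[t] K) →
    (Setting.DegUnbounded K (Setting.A K δ d cs a b) ⊎
    Setting.DegUnbounded K (Setting.B K δ d cs a b)) →
    Setting._≈K[t]_ K
    (Setting._+P_ K (Setting._*P_ K (Setting.C K (RingOps.⟦_⟧ˢ (Field.rawRing K) δ)) a) b)
    List.[] →
    (Kbar : AlgebraicClosure K c' ℓ') →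
    AlgebraicClosure.SigmaInfinite Kbar δ d cs a b
theorem5p1 K d 2≤d δ cs δ-even a b unbounded εa+b≈0 Kbar =
  unbounded⇒SigmaInfinite Kbar d cs 2≤d δ δ-even a b εa+b≈0
    (orbit-unbounded Kbar d cs 2≤d δ δ-even a b εa+b≈0 unbounded)
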